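{- Let $m \geq 2$ be an integer. Then $\alpha\left(F_{m,1}^{(2)}\right)=\left\lfloor \frac{m^{2}}{4}\right\rfloor$.
   Context: Graphs are finite and simple. For a graph $G$, the double vertex graph $G^{(2)}$ is the graph whose vertices are all $2$-subsets of $V(G)$, where two $2$-subsets are adjacent whenever their symmetric difference is (the set of endpoints of) an edge of $G$. The fan graph $F_{m,1}$ is the join $P_m+K_1$, where $P_m$ is the path graph with $m$ vertices and $K_1$ is the complete graph with one vertex (the join of two disjoint graphs adds all edges between them). $\alpha(G)$ denotes the independence number of $G$, i.e. the maximum cardinality of a set of pairwise non-adjacent vertices. -}

module Defs where

open import Data.Nat.Base using (ℕ; suc; _+_; _≤_)
open import Data.Nat.Properties using (1+n≢n)
open import Data.Fin.Base using (Fin; zero; suc; toℕ; splitAt)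
open import Data.Fin.Subset as Subset using (Subset; ⁅_⁆; _∪_; _─_; ∣_∣; inside; outside)
open import Data.Fin.Subset.Properties
  using (∪-comm; x∈⁅x⁆; p⊆p∪q; x∈p∪q⁻; drop-there)
open import Data.Vec.Base using (_∷_)
open import Data.List.Base using (List; length)
open import Data.List.Membership.Propositional using (_∈_)
open import Data.List.Relation.Unary.Unique.Propositional using (Unique)
open import Data.Product.Base using (Σ; ∃; ∃₂; _×_; _,_)
open import Data.Sum.Base using (_⊎_; inj₁; inj₂; swap)
open import Data.Unit.Base using (⊤; tt)
open import Relation.Binary.Core using (Rel)
open import Relation.Binary.Definitions using (Symmetric; Irreflexive)
open import Relation.Binary.PropositionalEquality
open import Relation.Nullary.Negation using (¬_)
open import Level using (0ℓ)

-- Finiteness is carried by the vertex type V: it is Fin n for the base graphs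
-- and the type of 2-subsets of Fin n for double vertex graphs.
record SimpleGraph (V : Set) : Set₁ where
  field
    Adj    : Rel V 0ℓ
    symm   : Symmetric Adj
    irrefl : Irreflexive _≡_ Adj

open SimpleGraph public

path : (m : ℕ) → SimpleGraph (Fin m)
path m .Adj i j = suc (toℕ i) ≡ toℕ j ⊎ suc (toℕ j) ≡ toℕ i
path m .symm = swap
path m .irrefl refl (inj₁ e) = 1+n≢n e
path m .irrefl refl (inj₂ e) = 1+n≢n e

complete : (n : ℕ) → SimpleGraph (Fin n)
complete n .Adj i j = i ≢ j
complete n .symm i≢j j≡i = i≢j (sym j≡i)
complete n .irrefl i≡j i≢j = i≢j i≡j

module _ {m n : ℕ} (G : SimpleGraph (Fin m)) (H : SimpleGraph (Fin n)) where

  JoinAdj : Rel (Fin m ⊎ Fin n) 0ℓ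
  JoinAdj (inj₁ i) (inj₁ j) = Adj G i j
  JoinAdj (inj₁ _) (inj₂ _) = ⊤
  JoinAdj (inj₂ _) (inj₁ _) = ⊤
  JoinAdj (inj₂ i) (inj₂ j) = Adj H i j

  private
    joinSymm : Symmetric JoinAdj
    joinSymm {inj₁ _} {inj₁ _} e = symm G e
    joinSymm {inj₁ _} {inj₂ _} _ = tt
    joinSymm {inj₂ _} {inj₁ _} _ = tt
    joinSymm {inj₂ _} {inj₂ _} e = symm H e

    joinIrrefl : Irreflexive _≡_ JoinAdj
    joinIrrefl {inj₁ _} refl e = irrefl G refl e
    joinIrrefl {inj₂ _} refl e = irrefl H refl e

  -- The disjoint union of the vertex sets is Fin (m + n): its first m elements
  -- are the vertices of G and its last n elements those of H.
  join : SimpleGraph (Fin (m + n))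
  join .Adj x y = JoinAdj (splitAt m x) (splitAt m y)
  join .symm {x} {y} = joinSymm {splitAt m x} {splitAt m y}
  join .irrefl x≡y = joinIrrefl (cong (splitAt m) x≡y)

fan : (m : ℕ) → SimpleGraph (Fin (m + 1))
fan m = join (path m) (complete 1)

-- The size proof is unique (ℕ is a set), so two elements are equal exactly
-- when the underlying subsets are.
TwoSubset : ℕ → Set
TwoSubset n = Σ (Subset n) λ p → ∣ p ∣ ≡ 2

infixl 6 _△_

_△_ : ∀ {n} → Subset n → Subset n → Subset n
p △ q = (p ─ q) ∪ (q ─ p)

private
  x∉p─p : ∀ {n} (p : Subset n) {x} → x Subset.∉ p ─ p
  x∉p─p (inside  ∷ p) {zero} ()
  x∉p─p (outside ∷ p) {zero} ()
  x∉p─p (_ ∷ p) {suc x} x∈ = x∉p─p p (drop-there x∈)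

doubleVertexGraph : ∀ {n} → SimpleGraph (Fin n) → SimpleGraph (TwoSubset n)
doubleVertexGraph G .Adj (p , _) (q , _) =
  ∃₂ λ u v → Adj G u v × p △ q ≡ ⁅ u ⁆ ∪ ⁅ v ⁆
doubleVertexGraph G .symm {p , _} {q , _} (u , v , e , eq) =
  u , v , e , trans (∪-comm (q ─ p) (p ─ q)) eq
doubleVertexGraph G .irrefl {p , _} refl (u , v , _ , eq)
  with x∈p∪q⁻ (p ─ p) (p ─ p)
         (subst (u Subset.∈_) (sym eq) (p⊆p∪q ⁅ v ⁆ (x∈⁅x⁆ u)))
... | inj₁ u∈p─p = x∉p─p p u∈p─p
... | inj₂ u∈p─p = x∉p─p p u∈p─p

-- A finite set of vertices is a duplicate-free list, with its length as
-- cardinality.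
IndependentSet : ∀ {V} → SimpleGraph V → List V → Set
IndependentSet G xs =
  Unique xs × (∀ {x y} → x ∈ xs → y ∈ xs → ¬ Adj G x y)

-- IndependenceNumber G k reads "α(G) = k".
IndependenceNumber : ∀ {V} → SimpleGraph V → ℕ → Set
IndependenceNumber G k =
  (∃ λ xs → IndependentSet G xs × length xs ≡ k) ×
  (∀ xs → IndependentSet G xs → length xs ≤ k)

{-# OPTIONS --safe #-}
-- Upper bound: writing c for the hub and 0, …, m − 1 for the path, the pairs (h , j) with
-- 2h < j < m index a clique cover of the double vertex graph. The clique (h , j) contains
-- {2h , j} and {2h+1 , j}, and if j = 2h+1 also {2h , c} and {2h+1 , c}, which completes a
-- triangle. If m is odd, {m−1 , c} is left over, and it is adjacent to both members of the
-- clique (0 , m−1). There are ⌈0/2⌉ + ⌈1/2⌉ + … + ⌈(m−1)/2⌉ = ⌊m²/4⌋ such cliques.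
--
-- Lower bound: the pairs {i , j} of path vertices with i + j odd are independent, since moving
-- one element along an edge of the path changes the parity of the sum; each clique (h , j)
-- contributes one of them, {j − 1 − 2h , j}.
module Submission where

open import Defs
open import Data.Nat using (ℕ; _≤_; _^_)
open import Data.Nat.DivMod using (_/_)

open import Algebra.Bundles using (CommutativeRing)
open import Data.Bool.Base using (Bool; true; false; not; _∧_; _xor_)
open import Data.Bool.Properties
  using ( xor-assoc; xor-comm; xor-same; xor-inverseʳ; xor-identityˡ; xor-identityʳ
        ; ∧-distribʳ-xor; xor-∧-commutativeRing )
open import Data.Fin.Base as Fin using (Fin; zero; suc; toℕ; fromℕ<; splitAt)
open import Data.Fin.Properties
  using (toℕ-fromℕ<; toℕ-injective; toℕ<n; splitAt-<; splitAt-≥; injective⇒≤)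
  renaming (<⇒≢ to <⇒≢ᶠ)
open import Data.Fin.Subset as Subset
  using (Subset; ⁅_⁆; _∪_; ∣_∣; inside; outside; ⊥)
open import Data.Fin.Subset.Properties
  using (∪-comm; ∪-identityˡ; ∪-identityʳ; x∈⁅x⁆; x∈⁅y⁆⇒x≡y; ∣⁅x⁆∣≡1; x∈p∪q⁻; x∈p∪q⁺)
open import Data.List.Base using (List; []; _∷_; _++_; map; upTo; length; lookup; tabulate)
open import Data.List.Membership.Propositional using (_∈_)
open import Data.List.Membership.Propositional.Properties
  using (∈-map⁺; ∈-map⁻; ∈-++⁺ˡ; ∈-++⁺ʳ; ∈-++⁻; ∈-upTo⁺; ∈-upTo⁻; ∈-lookup; ∈-tabulate⁻)
open import Data.List.Properties using (length-map; length-++; length-upTo; length-tabulate)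
open import Data.List.Relation.Unary.All as All using ()
open import Data.List.Relation.Unary.AllPairs using ([]; _∷_)
open import Data.List.Relation.Unary.Any using (index)
open import Data.List.Relation.Unary.Any.Properties using (lookup-index)
open import Data.List.Relation.Unary.Unique.Propositional using (Unique)
open import Data.List.Relation.Unary.Unique.Propositional.Properties
  using (map⁺; ++⁺; upTo⁺; tabulate⁺)
open import Data.Nat.Base
  using (zero; suc; pred; _+_; _*_; _∸_; _<_; s≤s; z<s; s<s; s≤s⁻¹; ⌊_/2⌋; ⌈_/2⌉)
open import Data.Nat.Divisibility using (n∣m*n)
open import Data.Nat.DivMod using (+-distrib-/-∣ʳ; m*n/n≡m)
open import Data.Nat.Properties
  using ( +-assoc; +-comm; +-suc; +-cancelˡ-≡; ≤-refl; ≤-trans; <-trans; <-irrefl; ≤-<-trans; _<?_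
        ; ≤-reflexive; m<n⇒m<1+n; m≤n⇒m<n∨m≡n; m≤m+n; m<m+n; m∸n+n≡m; m∸n≤m
        ; ⌊n/2⌋-mono; ⌊n/2⌋+⌈n/2⌉≡n; n≡⌊n+n/2⌋; ≡-irrelevant )
open import Data.Nat.Tactic.RingSolver using (solve-∀)
open import Data.Product.Base using (∃; ∃₂; _×_; _,_; proj₁; proj₂)
open import Data.Product.Properties using (,-injectiveˡ)
open import Data.Sum.Base as Sum using (_⊎_; inj₁; inj₂; [_,_]′)
open import Data.Vec.Base using ([]; _∷_; zipWith)
open import Data.Vec.Properties
  using (zipWith-assoc; zipWith-comm; zipWith-identityˡ; zipWith-identityʳ)
open import Function.Base using (_∘_; const)
open import Relation.Binary.PropositionalEquality
open import Relation.Nullary using (¬_; yes; no; contradiction)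

private
  variable
    n : ℕ

-- Clique covers bound independent sets

lookup-injective : ∀ {A : Set} {xs : List A} → Unique xs →
                   ∀ {i j} → lookup xs i ≡ lookup xs j → i ≡ j
lookup-injective (x∉xs ∷ _)  {zero}  {zero}  _  = refl
lookup-injective (x∉xs ∷ _)  {zero}  {suc j} eq = contradiction eq (All.lookup x∉xs (∈-lookup j))
lookup-injective (x∉xs ∷ _)  {suc i} {zero}  eq =
  contradiction (sym eq) (All.lookup x∉xs (∈-lookup i))
lookup-injective (_ ∷ xs!)   {suc i} {suc j} eq = cong suc (lookup-injective xs! eq)

-- Pigeonhole: sending each entry to the position of a clique containing it is injective, since two
-- entries in one clique are equal or adjacent.
independent≤cliqueCover :
  ∀ {V A : Set} (G : SimpleGraph V) (cliques : List A) (_∈ᶜ_ : V → A → Set) →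
  (∀ v → ∃ λ c → c ∈ cliques × v ∈ᶜ c) →
  (∀ {u v c} → u ∈ᶜ c → v ∈ᶜ c → u ≡ v ⊎ Adj G u v) →
  ∀ xs → IndependentSet G xs → length xs ≤ length cliques
independent≤cliqueCover G cliques _∈ᶜ_ cover clique xs (xs! , indep) =
  injective⇒≤ {f = f} f-injective
  where
  f : Fin (length xs) → Fin (length cliques)
  f i = index (proj₁ (proj₂ (cover (lookup xs i))))

  in-f : ∀ i → lookup xs i ∈ᶜ lookup cliques (f i)
  in-f i with c , c∈ , v∈c ← cover (lookup xs i) = subst (lookup xs i ∈ᶜ_) (lookup-index c∈) v∈c

  f-injective : ∀ {i j} → f i ≡ f j → i ≡ j
  f-injective {i} {j} eq
    with clique (in-f i) (subst (λ k → lookup xs j ∈ᶜ lookup cliques k) (sym eq) (in-f j))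
  ... | inj₁ u≡v = lookup-injective xs! u≡v
  ... | inj₂ u~v = contradiction u~v (indep (∈-lookup i) (∈-lookup j))

-- The vector space of subsets over the field with two elements

infixl 6 _⊕_

_⊕_ : Subset n → Subset n → Subset n
_⊕_ = zipWith _xor_

-- Carries adjacency over to a group operation, where a shared element cancels.
△≡⊕ : (p q : Subset n) → p △ q ≡ p ⊕ q
△≡⊕ []            []            = refl
△≡⊕ (inside  ∷ p) (inside  ∷ q) = cong (outside ∷_) (△≡⊕ p q)
△≡⊕ (inside  ∷ p) (outside ∷ q) = cong (inside ∷_) (△≡⊕ p q)
△≡⊕ (outside ∷ p) (inside  ∷ q) = cong (inside ∷_) (△≡⊕ p q)
△≡⊕ (outside ∷ p) (outside ∷ q) = cong (outside ∷_) (△≡⊕ p q)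

⊕-identityˡ : (p : Subset n) → ⊥ ⊕ p ≡ p
⊕-identityˡ = zipWith-identityˡ xor-identityˡ

⊕-identityʳ : (p : Subset n) → p ⊕ ⊥ ≡ p
⊕-identityʳ = zipWith-identityʳ xor-identityʳ

⊕-assoc : (p q r : Subset n) → (p ⊕ q) ⊕ r ≡ p ⊕ (q ⊕ r)
⊕-assoc = zipWith-assoc xor-assoc

⊕-comm : (p q : Subset n) → p ⊕ q ≡ q ⊕ p
⊕-comm = zipWith-comm xor-comm

⊕-cancel : (p q : Subset n) → p ⊕ (p ⊕ q) ≡ q
⊕-cancel []      []      = refl
⊕-cancel (s ∷ p) (t ∷ q) = cong₂ _∷_
  (trans (sym (xor-assoc s s t)) (cong (_xor t) (xor-same s))) (⊕-cancel p q)

-- Two-element subsets as pairs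

pair : Fin n → Fin n → Subset n
pair x y = ⁅ x ⁆ ∪ ⁅ y ⁆

pair-comm : (x y : Fin n) → pair x y ≡ pair y x
pair-comm x y = ∪-comm ⁅ x ⁆ ⁅ y ⁆

pair≡⊕ : {x y : Fin n} → x ≢ y → pair x y ≡ ⁅ x ⁆ ⊕ ⁅ y ⁆
pair≡⊕ {x = zero}  {zero}  x≢y = contradiction refl x≢y
pair≡⊕ {x = zero}  {suc y} _   =
  cong (inside ∷_) (trans (∪-identityˡ ⁅ y ⁆) (sym (⊕-identityˡ ⁅ y ⁆)))
pair≡⊕ {x = suc x} {zero}  _   =
  cong (inside ∷_) (trans (∪-identityʳ ⁅ x ⁆) (sym (⊕-identityʳ ⁅ x ⁆)))
pair≡⊕ {x = suc x} {suc y} x≢y = cong (outside ∷_) (pair≡⊕ (x≢y ∘ cong suc))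

∣pair∣≡2 : {x y : Fin n} → x ≢ y → ∣ pair x y ∣ ≡ 2
∣pair∣≡2 {x = zero}  {zero}  x≢y = contradiction refl x≢y
∣pair∣≡2 {x = zero}  {suc y} _   =
  cong suc (trans (cong ∣_∣ (∪-identityˡ ⁅ y ⁆)) (∣⁅x⁆∣≡1 y))
∣pair∣≡2 {x = suc x} {zero}  _   =
  cong suc (trans (cong ∣_∣ (∪-identityʳ ⁅ x ⁆)) (∣⁅x⁆∣≡1 x))
∣pair∣≡2 {x = suc x} {suc y} x≢y = ∣pair∣≡2 (x≢y ∘ cong suc)

∣p∣≡0⇒p≡⊥ : (p : Subset n) → ∣ p ∣ ≡ 0 → p ≡ ⊥
∣p∣≡0⇒p≡⊥ []            _ = refl
∣p∣≡0⇒p≡⊥ (outside ∷ p) e = cong (outside ∷_) (∣p∣≡0⇒p≡⊥ p e)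

∣p∣≡1⇒singleton : (p : Subset n) → ∣ p ∣ ≡ 1 → ∃ λ x → p ≡ ⁅ x ⁆
∣p∣≡1⇒singleton (inside  ∷ p) e =
  zero , cong (inside ∷_) (∣p∣≡0⇒p≡⊥ p (cong pred e))
∣p∣≡1⇒singleton (outside ∷ p) e with x , refl ← ∣p∣≡1⇒singleton p e = suc x , refl

-- The order `x < y` is a normal form; in the fan it also forces the hub, the largest vertex, to be
-- `y`.
∣p∣≡2⇒pair : (p : Subset n) → ∣ p ∣ ≡ 2 → ∃₂ λ x y → x Fin.< y × p ≡ pair x y
∣p∣≡2⇒pair (inside  ∷ p) e with y , refl ← ∣p∣≡1⇒singleton p (cong pred e) =
  zero , suc y , z<s , cong (inside ∷_) (sym (∪-identityˡ ⁅ y ⁆))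
∣p∣≡2⇒pair (outside ∷ p) e with x , y , x<y , refl ← ∣p∣≡2⇒pair p e =
  suc x , suc y , s<s x<y , refl

TwoSubset-≡ : {p q : TwoSubset n} → proj₁ p ≡ proj₁ q → p ≡ q
TwoSubset-≡ {p = p , _} refl = cong (p ,_) (≡-irrelevant _ _)

∈-pair⁻ : {x y z : Fin n} → z Subset.∈ pair x y → z ≡ x ⊎ z ≡ y
∈-pair⁻ {x = x} {y} z∈ with x∈p∪q⁻ ⁅ x ⁆ ⁅ y ⁆ z∈
... | inj₁ z∈x = inj₁ (x∈⁅y⁆⇒x≡y x z∈x)
... | inj₂ z∈y = inj₂ (x∈⁅y⁆⇒x≡y y z∈y)

pair-injective : {x y x′ y′ : Fin n} → x Fin.< y → x′ Fin.< y′ →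
                 pair x y ≡ pair x′ y′ → x ≡ x′ × y ≡ y′
pair-injective {x = x} {y} {x′} {y′} x<y x′<y′ eq
  with ∈-pair⁻ (subst (x Subset.∈_) eq (x∈p∪q⁺ (inj₁ (x∈⁅x⁆ x))))
     | ∈-pair⁻ (subst (y Subset.∈_) eq (x∈p∪q⁺ {p = ⁅ x ⁆} (inj₂ (x∈⁅x⁆ y))))
... | inj₁ refl | inj₁ refl = contradiction x<y (<-irrefl refl)
... | inj₁ x≡x′ | inj₂ y≡y′ = x≡x′ , y≡y′
... | inj₂ refl | inj₁ refl = contradiction x<y (λ x<y → <-irrefl refl (<-trans x<y x′<y′))
... | inj₂ refl | inj₂ refl = contradiction x<y (<-irrefl refl)

pair-△-pair : {x y z : Fin n} → x ≢ y → x ≢ z → y ≢ z → pair x y △ pair x z ≡ pair y z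
pair-△-pair {x = x} {y} {z} x≢y x≢z y≢z = begin
  pair x y △ pair x z                   ≡⟨ △≡⊕ (pair x y) (pair x z) ⟩
  pair x y ⊕ pair x z                   ≡⟨ cong₂ _⊕_ (pair≡⊕ x≢y) (pair≡⊕ x≢z) ⟩
  (⁅ x ⁆ ⊕ ⁅ y ⁆) ⊕ (⁅ x ⁆ ⊕ ⁅ z ⁆)     ≡⟨ cong (_⊕ (⁅ x ⁆ ⊕ ⁅ z ⁆)) (⊕-comm ⁅ x ⁆ ⁅ y ⁆) ⟩
  (⁅ y ⁆ ⊕ ⁅ x ⁆) ⊕ (⁅ x ⁆ ⊕ ⁅ z ⁆)     ≡⟨ ⊕-assoc ⁅ y ⁆ ⁅ x ⁆ (⁅ x ⁆ ⊕ ⁅ z ⁆) ⟩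
  ⁅ y ⁆ ⊕ (⁅ x ⁆ ⊕ (⁅ x ⁆ ⊕ ⁅ z ⁆))     ≡⟨ cong (⁅ y ⁆ ⊕_) (⊕-cancel ⁅ x ⁆ ⁅ z ⁆) ⟩
  ⁅ y ⁆ ⊕ ⁅ z ⁆                         ≡⟨ pair≡⊕ y≢z ⟨
  pair y z                              ∎
  where open ≡-Reasoning

-- Moving one element along an edge while the other stays fixed: every adjacency inside the cliques
-- has this form.
pair-adjacent : (G : SimpleGraph (Fin n)) {x y z : Fin n} → x ≢ y → x ≢ z → Adj G y z →
                ∀ e e′ → Adj (doubleVertexGraph G) (pair x y , e) (pair x z , e′)
pair-adjacent G {y = y} {z} x≢y x≢z y~z _ _ =
  y , z , y~z , pair-△-pair x≢y x≢z (λ y≡z → irrefl G y≡z y~z)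

-- Linear functionals on subsets

weight : (Fin n → Bool) → Subset n → Bool
weight χ []      = false
weight χ (s ∷ p) = (s ∧ χ zero) xor weight (χ ∘ suc) p

weight-⊥ : ∀ {n} (χ : Fin n → Bool) → weight χ ⊥ ≡ false
weight-⊥ {zero}  χ = refl
weight-⊥ {suc n} χ = weight-⊥ (χ ∘ suc)

weight-⁅⁆ : (χ : Fin n → Bool) (x : Fin n) → weight χ ⁅ x ⁆ ≡ χ x
weight-⁅⁆ χ zero    = trans (cong (χ zero xor_) (weight-⊥ (χ ∘ suc))) (xor-identityʳ (χ zero))
weight-⁅⁆ χ (suc x) = weight-⁅⁆ (χ ∘ suc) x

weight-⊕ : (χ : Fin n → Bool) (p q : Subset n) →
           weight χ (p ⊕ q) ≡ weight χ p xor weight χ q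
weight-⊕ χ []      []      = refl
weight-⊕ χ (s ∷ p) (t ∷ q) = begin
  ((s xor t) ∧ c) xor weight χ′ (p ⊕ q)
    ≡⟨ cong₂ _xor_ (∧-distribʳ-xor c s t) (weight-⊕ χ′ p q) ⟩
  ((s ∧ c) xor (t ∧ c)) xor (weight χ′ p xor weight χ′ q)
    ≡⟨ interchange (s ∧ c) (t ∧ c) (weight χ′ p) (weight χ′ q) ⟩
  ((s ∧ c) xor weight χ′ p) xor ((t ∧ c) xor weight χ′ q)
    ∎
  where
  open ≡-Reasoning
  open import Algebra.Properties.CommutativeSemigroup
    (CommutativeRing.+-commutativeSemigroup xor-∧-commutativeRing) using (interchange)
  c  = χ zero
  χ′ = χ ∘ suc

weight-pair : (χ : Fin n → Bool) {x y : Fin n} → x ≢ y → weight χ (pair x y) ≡ χ x xor χ y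
weight-pair χ {x} {y} x≢y = begin
  weight χ (pair x y)                ≡⟨ cong (weight χ) (pair≡⊕ x≢y) ⟩
  weight χ (⁅ x ⁆ ⊕ ⁅ y ⁆)           ≡⟨ weight-⊕ χ ⁅ x ⁆ ⁅ y ⁆ ⟩
  weight χ ⁅ x ⁆ xor weight χ ⁅ y ⁆  ≡⟨ cong₂ _xor_ (weight-⁅⁆ χ x) (weight-⁅⁆ χ y) ⟩
  χ x xor χ y                        ∎
  where open ≡-Reasoning

-- By linearity a functional changes along an edge of the double vertex graph exactly as `χ` does
-- along an edge of `G`, with no cases on which elements are shared. The edge comes before `χ`, so
-- `χ` may be chosen to suit it.
adjacent-weight : (G : SimpleGraph (Fin n)) {p q : TwoSubset n} →
                  Adj (doubleVertexGraph G) p q →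
                  ∃₂ λ u v → Adj G u v ×
                    (∀ χ → weight χ (proj₁ p) xor weight χ (proj₁ q) ≡ χ u xor χ v)
adjacent-weight G {p , _} {q , _} (u , v , u~v , eq) = u , v , u~v , λ χ → begin
  weight χ p xor weight χ q  ≡⟨ weight-⊕ χ p q ⟨
  weight χ (p ⊕ q)           ≡⟨ cong (weight χ) (△≡⊕ p q) ⟨
  weight χ (p △ q)           ≡⟨ cong (weight χ) eq ⟩
  weight χ (pair u v)        ≡⟨ weight-pair χ (λ u≡v → irrefl G u≡v u~v) ⟩
  χ u xor χ v                ∎
  where open ≡-Reasoning

-- The index set of the clique cover

private
  variable
    a b h j m : ℕ

-- The condition 2h < j appears as `h < ⌈ j /2⌉`, so the block of a given j is an initial segment of
-- the naturals.
slots : ℕ → List (ℕ × ℕ)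
slots zero    = []
slots (suc m) = map (_, m) (upTo ⌈ m /2⌉) ++ slots m

∈-slots⁺ : ∀ m → h < ⌈ j /2⌉ → j < m → (h , j) ∈ slots m
∈-slots⁺ (suc m) h< j<1+m with m≤n⇒m<n∨m≡n (s≤s⁻¹ j<1+m)
... | inj₁ j<m  = ∈-++⁺ʳ (map (_, m) (upTo ⌈ m /2⌉)) (∈-slots⁺ m h< j<m)
... | inj₂ refl = ∈-++⁺ˡ (∈-map⁺ (_, m) (∈-upTo⁺ h<))

∈-slots⁻ : ∀ m → (h , j) ∈ slots m → h < ⌈ j /2⌉ × j < m
∈-slots⁻ (suc m) s∈ with ∈-++⁻ (map (_, m) (upTo ⌈ m /2⌉)) s∈
... | inj₁ s∈m with _ , h∈ , refl ← ∈-map⁻ (_, m) s∈m = ∈-upTo⁻ h∈ , ≤-refl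
... | inj₂ s∈m with h< , j<m ← ∈-slots⁻ m s∈m = h< , m<n⇒m<1+n j<m

slots-unique : ∀ m → Unique (slots m)
slots-unique zero    = []
slots-unique (suc m) = ++⁺ (map⁺ ,-injectiveˡ (upTo⁺ ⌈ m /2⌉)) (slots-unique m) disjoint
  where
  disjoint : ∀ {s} → ¬ (s ∈ map (_, m) (upTo ⌈ m /2⌉) × s ∈ slots m)
  disjoint (s∈ , s∈′) with _ , _ , refl ← ∈-map⁻ (_, m) s∈ =
    <-irrefl refl (proj₂ (∈-slots⁻ m s∈′))

length-slots-suc : ∀ m → length (slots (suc m)) ≡ ⌈ m /2⌉ + length (slots m)
length-slots-suc m = begin
  length (map (_, m) (upTo ⌈ m /2⌉) ++ slots m)
    ≡⟨ length-++ (map (_, m) (upTo ⌈ m /2⌉)) ⟩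
  length (map (_, m) (upTo ⌈ m /2⌉)) + length (slots m)
    ≡⟨ cong (_+ length (slots m))
         (trans (length-map (_, m) (upTo ⌈ m /2⌉)) (length-upTo ⌈ m /2⌉)) ⟩
  ⌈ m /2⌉ + length (slots m)
    ∎
  where open ≡-Reasoning

-- Induction in steps of two: two consecutive blocks add ⌈(m+1)/2⌉ + ⌈m/2⌉ = m + 1, and (m+2)² = m²
-- + 4(m+1).
length-slots : ∀ m → length (slots m) ≡ m ^ 2 / 4
length-slots zero          = refl
length-slots (suc zero)    = refl
length-slots (suc (suc m)) = begin
  length (slots (2 + m))
    ≡⟨ length-slots-suc (suc m) ⟩
  suc ⌊ m /2⌋ + length (slots (1 + m))
    ≡⟨ cong (suc ⌊ m /2⌋ +_) (length-slots-suc m) ⟩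
  suc ⌊ m /2⌋ + (⌈ m /2⌉ + length (slots m))
    ≡⟨ +-assoc (suc ⌊ m /2⌋) ⌈ m /2⌉ _ ⟨
  suc (⌊ m /2⌋ + ⌈ m /2⌉) + length (slots m)
    ≡⟨ cong₂ (λ k l → suc k + l) (⌊n/2⌋+⌈n/2⌉≡n m) (length-slots m) ⟩
  suc m + m ^ 2 / 4
    ≡⟨ +-comm (suc m) (m ^ 2 / 4) ⟩
  m ^ 2 / 4 + suc m
    ≡⟨ cong (m ^ 2 / 4 +_) (m*n/n≡m (suc m) 4) ⟨
  m ^ 2 / 4 + suc m * 4 / 4
    ≡⟨ +-distrib-/-∣ʳ (m ^ 2) (n∣m*n (suc m)) ⟨
  (m ^ 2 + suc m * 4) / 4
    ≡⟨ cong (_/ 4) (square m) ⟩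
  (2 + m) ^ 2 / 4
    ∎
  where
  open ≡-Reasoning
  square : ∀ m → m * (m * 1) + suc m * 4 ≡ (2 + m) * ((2 + m) * 1)
  square = solve-∀

h<⌈j/2⌉⇒h+h<j : ∀ h j → h < ⌈ j /2⌉ → h + h < j
h<⌈j/2⌉⇒h+h<j zero    (suc j)       _         = z<s
h<⌈j/2⌉⇒h+h<j (suc h) (suc zero)    (s≤s ())
h<⌈j/2⌉⇒h+h<j (suc h) (suc (suc j)) (s≤s h<)
  rewrite +-suc h h = s≤s (s≤s (h<⌈j/2⌉⇒h+h<j h j h<))

⌊/2⌋-double : ∀ a → a ≡ ⌊ a /2⌋ + ⌊ a /2⌋ ⊎ a ≡ suc (⌊ a /2⌋ + ⌊ a /2⌋)
⌊/2⌋-double zero          = inj₁ refl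
⌊/2⌋-double (suc zero)    = inj₂ refl
⌊/2⌋-double (suc (suc a)) rewrite +-suc ⌊ a /2⌋ ⌊ a /2⌋ with ⌊/2⌋-double a
... | inj₁ eq = inj₁ (cong (2 +_) eq)
... | inj₂ eq = inj₂ (cong (2 +_) eq)

-- Both numbers lie in {2h , 2h+1} for the common half h; the unequal case is phrased as adjacency
-- in the path.
⌊/2⌋-≡ : ∀ a b → ⌊ a /2⌋ ≡ ⌊ b /2⌋ → a ≡ b ⊎ (suc a ≡ b ⊎ suc b ≡ a)
⌊/2⌋-≡ a b eq with ⌊/2⌋-double a | ⌊/2⌋-double b
... | p | q rewrite eq with p | q
...   | inj₁ p | inj₁ q = inj₁ (trans p (sym q))
...   | inj₁ p | inj₂ q = inj₂ (inj₁ (trans (cong suc p) (sym q)))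
...   | inj₂ p | inj₁ q = inj₂ (inj₂ (trans (cong suc q) (sym p)))
...   | inj₂ p | inj₂ q = inj₁ (trans p (sym q))

-- Edges of the fan and the clique cover

fan-path-edge : {x y : Fin (m + 1)} → toℕ x < m → toℕ y < m →
                suc (toℕ x) ≡ toℕ y ⊎ suc (toℕ y) ≡ toℕ x → Adj (fan m) x y
fan-path-edge {m} {x} {y} x<m y<m e
  rewrite splitAt-< m x x<m | splitAt-< m y y<m | toℕ-fromℕ< x<m | toℕ-fromℕ< y<m = e

fan-hub-edge : {x z : Fin (m + 1)} → toℕ x < m → toℕ z ≡ m → Adj (fan m) x z
fan-hub-edge {m} {x} {z} x<m z≡m
  rewrite splitAt-< m x x<m | splitAt-≥ m z (≤-reflexive (sym z≡m)) = _

-- last is only needed at the final vertex of an odd path, but it is sound everywhere: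
-- {0 , j}, {1 , j} and {j , c} are pairwise adjacent for every j.
data SpokeSlot : (h j a : ℕ) → Set where
  triangle : ⌊ a /2⌋ ≡ h → SpokeSlot h (suc (h + h)) a
  last     : SpokeSlot 0 a a

-- `base` holds pairs of path vertices, `spoke` pairs with the hub, which is recognised by its index
-- m.
data _∈Clique_ {m : ℕ} : TwoSubset (m + 1) → ℕ × ℕ → Set where
  base  : ∀ {x y e} → ⌊ toℕ x /2⌋ ≡ h → x Fin.< y → toℕ y ≡ j → j < m →
          (pair x y , e) ∈Clique (h , j)
  spoke : ∀ {x z e} → toℕ x < m → toℕ z ≡ m → SpokeSlot h j (toℕ x) →
          (pair x z , e) ∈Clique (h , j)

-- A spoke at x goes to the triangle with j = 2⌊x/2⌋+1 if that j is on the path. Otherwise m is odd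
-- and x = m-1, and the slot (0 , x) takes it.
clique-cover : 2 ≤ m → (p : TwoSubset (m + 1)) → ∃ λ s → s ∈ slots m × p ∈Clique s
clique-cover {m} 2≤m (p , e) with ∣p∣≡2⇒pair p e
... | x , y , x<y , refl with toℕ y <? m
-- Halving x + 2 ≤ y + 1 gives 1 + ⌊x/2⌋ ≤ ⌈y/2⌉.
... | yes y<m = (⌊ toℕ x /2⌋ , toℕ y) , ∈-slots⁺ m (⌊n/2⌋-mono (s≤s x<y)) y<m
                                      , base refl x<y refl y<m
... | no  y≮m with m≤n⇒m<n∨m≡n (s≤s⁻¹ (subst (toℕ y <_) (+-comm m 1) (toℕ<n y)))
... | inj₁ y<m = contradiction y<m y≮m
... | inj₂ y≡m with suc (⌊ toℕ x /2⌋ + ⌊ toℕ x /2⌋) <? m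
... | yes j<m = _ , ∈-slots⁺ m (s≤s (≤-reflexive (n≡⌊n+n/2⌋ ⌊ toℕ x /2⌋))) j<m
                  , spoke (subst (toℕ x <_) y≡m x<y) y≡m (triangle refl)
... | no  j≮m = (0 , toℕ x) , ∈-slots⁺ m (0<⌈/2⌉ (toℕ x) j≮m) x<m , spoke x<m y≡m last
  where
  x<m : toℕ x < m
  x<m = subst (toℕ x <_) y≡m x<y
  0<⌈/2⌉ : ∀ a → ¬ (suc (⌊ a /2⌋ + ⌊ a /2⌋) < m) → 0 < ⌈ a /2⌉
  -- Here `2 ≤ m` enters: there is no slot (0 , 0), and x = 0 gets here only if 1 < m fails.
  0<⌈/2⌉ zero    2≰m = contradiction 2≤m 2≰m
  0<⌈/2⌉ (suc a) _   = z<s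

-- Adjacency inside a clique

fan₂ : ∀ m → SimpleGraph (TwoSubset (m + 1))
fan₂ m = doubleVertexGraph (fan m)

-- The shared element `c` is a path vertex when two base pairs are compared and the hub when two
-- spokes are.
equalHalves-clique : {x x′ c : Fin (m + 1)} → toℕ x < m → toℕ x′ < m → x ≢ c → x′ ≢ c →
                ⌊ toℕ x /2⌋ ≡ ⌊ toℕ x′ /2⌋ → ∀ {e e′} →
                _≡_ {A = TwoSubset (m + 1)} (pair x c , e) (pair x′ c , e′) ⊎
                Adj (fan₂ m) (pair x c , e) (pair x′ c , e′)
equalHalves-clique {m} {x} {x′} {c} x<m x′<m x≢c x′≢c eq {e} {e′} with ⌊/2⌋-≡ (toℕ x) (toℕ x′) eq
... | inj₁ x≡x′ = inj₁ (TwoSubset-≡ (cong (λ x → pair x c) (toℕ-injective x≡x′)))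
... | inj₂ near rewrite pair-comm x c | pair-comm x′ c =
  inj₂ (pair-adjacent (fan m) (≢-sym x≢c) (≢-sym x′≢c) (fan-path-edge x<m x′<m near) e e′)

hub≢ : {x z : Fin (m + 1)} → toℕ x < m → toℕ z ≡ m → x ≢ z
hub≢ x<m z≡m = <⇒≢ᶠ (subst (_ <_) (sym z≡m) x<m)

-- The two constructors share only the slot (0 , 1), where `last` gives the number 1, whose half is
-- also 0.
spokeSlot-half : SpokeSlot h j a → SpokeSlot h j b → ⌊ a /2⌋ ≡ ⌊ b /2⌋
spokeSlot-half (triangle p) (triangle q) = trans p (sym q)
spokeSlot-half (triangle p) last         = p
spokeSlot-half last         (triangle q) = sym q
spokeSlot-half last         last         = refl

-- In a triangle slot j = 2h+1, so a < j with half h leaves only a = 2h, and b is one of 2h and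
-- 2h+1. Hence a spoke shares its path vertex with any base pair of its slot.
spokeSlot-base : ⌊ a /2⌋ ≡ h → a < j → SpokeSlot h j b → b ≡ a ⊎ b ≡ j
spokeSlot-base _ _ last = inj₂ refl
spokeSlot-base {a} {b = b} refl a<j (triangle eq) with ⌊/2⌋-double b | ⌊/2⌋-double a
... | inj₂ q | _      = inj₂ (trans q (cong (λ h → suc (h + h)) eq))
... | inj₁ q | inj₁ r = inj₁ (trans q (trans (cong (λ h → h + h) eq) (sym r)))
... | inj₁ q | inj₂ r = contradiction a<j (<-irrefl r)

-- The shared path vertex stays, and the other one moves to the hub.
base-spoke-adjacent : {x y x′ z : Fin (m + 1)} → x Fin.< y → toℕ y < m → toℕ z ≡ m →
                      x′ ≡ x ⊎ x′ ≡ y → ∀ e e′ → Adj (fan₂ m) (pair x y , e) (pair x′ z , e′)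
base-spoke-adjacent {m} x<y y<m z≡m (inj₁ refl) e e′ =
  pair-adjacent (fan m) (<⇒≢ᶠ x<y) (hub≢ (<-trans x<y y<m) z≡m) (fan-hub-edge y<m z≡m) e e′
base-spoke-adjacent {m} {x} {y} x<y y<m z≡m (inj₂ refl) e e′ rewrite pair-comm x y =
  pair-adjacent (fan m) (≢-sym (<⇒≢ᶠ x<y)) (hub≢ y<m z≡m)
    (fan-hub-edge (<-trans x<y y<m) z≡m) e e′

base-spoke-clique : ∀ {x y x′ z : Fin (m + 1)} →
                    ⌊ toℕ x /2⌋ ≡ h → x Fin.< y → toℕ y ≡ j → j < m → toℕ z ≡ m → SpokeSlot h j (toℕ x′) →
                    ∀ e e′ → Adj (fan₂ m) (pair x y , e) (pair x′ z , e′)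
base-spoke-clique half x<y refl y<m z≡m s =
  base-spoke-adjacent x<y y<m z≡m
    (Sum.map toℕ-injective toℕ-injective (spokeSlot-base half x<y s))

clique-adjacent : ∀ {m} {p q : TwoSubset (m + 1)} {s} → p ∈Clique s → q ∈Clique s →
                  p ≡ q ⊎ Adj (fan₂ m) p q
clique-adjacent (base half x<y refl j<m) (base half′ x′<y′ j≡ _)
  with refl ← toℕ-injective j≡ =
  equalHalves-clique (<-trans x<y j<m) (<-trans x′<y′ j<m) (<⇒≢ᶠ x<y) (<⇒≢ᶠ x′<y′)
    (trans half (sym half′))
clique-adjacent (base {e = e} half x<y y≡j j<m) (spoke {e = e′} _ z≡m s) =
  inj₂ (base-spoke-clique half x<y y≡j j<m z≡m s e e′)
clique-adjacent {m} {p} {q} (spoke {e = e′} _ z≡m s) (base {e = e} half x<y y≡j j<m) =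
  inj₂ (symm (fan₂ m) {q} {p} (base-spoke-clique half x<y y≡j j<m z≡m s e e′))
clique-adjacent (spoke x<m z≡m s) (spoke x′<m z′≡m s′)
  with refl ← toℕ-injective (trans z≡m (sym z′≡m)) =
  equalHalves-clique x<m x′<m (hub≢ x<m z≡m) (hub≢ x′<m z≡m) (spokeSlot-half s s′)

-- The independent set of pairs with odd sum

odd : ℕ → Bool
odd zero    = false
odd (suc k) = not (odd k)

odd-double : ∀ k → odd (k + k) ≡ false
odd-double zero    = refl
odd-double (suc k) rewrite +-suc k k | odd-double k = refl

odd-+-odd : ∀ i k → odd (i + suc (k + k)) ≡ not (odd i)
odd-+-odd zero    k = cong not (odd-double k)
odd-+-odd (suc i) k = cong not (odd-+-odd i k)

isHub : ∀ m → Fin (m + 1) → Bool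
isHub m x = [ const false , const true ]′ (splitAt m x)

isOdd : ∀ m → Fin (m + 1) → Bool
isOdd m x = [ odd ∘ toℕ , const false ]′ (splitAt m x)

isHub-path : {x : Fin (m + 1)} → toℕ x < m → isHub m x ≡ false
isHub-path {m} {x} x<m rewrite splitAt-< m x x<m = refl

isOdd-path : {x : Fin (m + 1)} → toℕ x < m → isOdd m x ≡ odd (toℕ x)
isOdd-path {m} {x} x<m rewrite splitAt-< m x x<m = cong odd (toℕ-fromℕ< x<m)

odd-suc : suc a ≡ b → odd a xor odd b ≡ true
odd-suc {a} refl = xor-inverseʳ (odd a)

-- Path edges flip parity. Hub edges, across which `isOdd` may stay constant, flip `isHub`.
fan-edge⁻ : {u v : Fin (m + 1)} → Adj (fan m) u v →
            isOdd m u xor isOdd m v ≡ true ⊎ isHub m u xor isHub m v ≡ true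
fan-edge⁻ {m} {u} {v} u~v with splitAt m u | splitAt m v
... | inj₁ i    | inj₁ j    =
  inj₁ ([ odd-suc , trans (xor-comm (odd (toℕ i)) (odd (toℕ j))) ∘ odd-suc ]′ u~v)
... | inj₁ _    | inj₂ _    = inj₂ refl
... | inj₂ _    | inj₁ _    = inj₂ refl
... | inj₂ zero | inj₂ zero = contradiction refl u~v

-- Two path vertices with odd sum, expressed by two functionals: a subset contains the hub at most
-- once, so even `isHub` weight means not at all.
record IsOddPair (m : ℕ) (p : TwoSubset (m + 1)) : Set where
  field
    hubless   : weight (isHub m) (proj₁ p) ≡ false
    oddWeight : weight (isOdd m) (proj₁ p) ≡ true

open IsOddPair

-- Both functionals are constant on odd pairs, whereas every fan edge changes one of them.
isOddPair⇒nonadjacent : {p q : TwoSubset (m + 1)} → IsOddPair m p → IsOddPair m q →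
                       ¬ Adj (fan₂ m) p q
isOddPair⇒nonadjacent {m} {p} {q} p-odd q-odd p~q
  with u , v , u~v , weights ← adjacent-weight (fan m) {p} {q} p~q
  with fan-edge⁻ {m} {u} {v} u~v
... | inj₁ odd≡ with () ← trans (sym (trans (weights (isOdd m)) odd≡))
                                (cong₂ _xor_ (oddWeight p-odd) (oddWeight q-odd))
... | inj₂ hub≡ with () ← trans (sym (trans (weights (isHub m)) hub≡))
                                (cong₂ _xor_ (hubless p-odd) (hubless q-odd))

-- The pair {j - 1 - 2h , j}, with its odd gap 2h+1 stated additively to avoid truncated
-- subtraction.
record SlotPair (m : ℕ) (s : ℕ × ℕ) : Set where
  field
    low high : Fin (m + 1)
    gap      : toℕ low + suc (proj₁ s + proj₁ s) ≡ toℕ high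
    top      : toℕ high ≡ proj₂ s
    top<m    : toℕ high < m

  low<high : low Fin.< high
  low<high = subst (toℕ low <_) gap (m<m+n (toℕ low) z<s)

  subset : TwoSubset (m + 1)
  subset = pair low high , ∣pair∣≡2 (<⇒≢ᶠ low<high)

slotPair : ∀ m {s} → s ∈ slots m → SlotPair m s
slotPair m {h , j} s∈ = record
  { low   = fromℕ< i<m+1
  ; high  = fromℕ< j<m+1
  ; gap   = trans (cong (_+ suc (h + h)) (toℕ-fromℕ< i<m+1))
              (trans i+gap≡j (sym (toℕ-fromℕ< j<m+1)))
  ; top   = toℕ-fromℕ< j<m+1
  ; top<m = subst (_< m) (sym (toℕ-fromℕ< j<m+1)) j<m
  }
  where
  j<m : j < m
  j<m = proj₂ (∈-slots⁻ m s∈)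
  j<m+1 : j < m + 1
  j<m+1 = ≤-trans j<m (m≤m+n m 1)
  i<m+1 : j ∸ suc (h + h) < m + 1
  i<m+1 = ≤-<-trans (m∸n≤m j (suc (h + h))) j<m+1
  i+gap≡j : j ∸ suc (h + h) + suc (h + h) ≡ j
  -- The slot condition 2h < j is what keeps the subtraction from truncating.
  i+gap≡j = m∸n+n≡m (h<⌈j/2⌉⇒h+h<j h j (proj₁ (∈-slots⁻ m s∈)))

open SlotPair

-- The larger element is j and the gap determines h, so the slot can be read off the pair.
slotPair-injective : ∀ {m s t} (P : SlotPair m s) (Q : SlotPair m t) → subset P ≡ subset Q → s ≡ t
slotPair-injective {s = h , j} {k , l} P Q eq
  with x≡ , y≡ ← pair-injective (low<high P) (low<high Q) (cong proj₁ eq) = cong₂ _,_ h≡k j≡l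
  where
  j≡l : j ≡ l
  j≡l = trans (sym (top P)) (trans (cong toℕ y≡) (top Q))
  gaps : toℕ (low P) + suc (h + h) ≡ toℕ (low P) + suc (k + k)
  gaps = trans (gap P) (trans (cong toℕ y≡)
           (trans (sym (gap Q)) (cong (λ x → toℕ x + suc (k + k)) (sym x≡))))
  h≡k : h ≡ k
  h≡k = trans (n≡⌊n+n/2⌋ h) (trans (cong (⌊_/2⌋ ∘ pred) (+-cancelˡ-≡ (toℕ (low P)) _ _ gaps))
          (sym (n≡⌊n+n/2⌋ k)))

slotPair-isOddPair : ∀ {m s} (P : SlotPair m s) → IsOddPair m (subset P)
slotPair-isOddPair {m} {h , j} P = record
  { hubless   = trans (weight-pair (isHub m) low≢high)
                  (cong₂ _xor_ (isHub-path low<m) (isHub-path (top<m P)))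
  ; oddWeight = begin
      weight (isOdd m) (pair (low P) (high P))
        ≡⟨ weight-pair (isOdd m) low≢high ⟩
      isOdd m (low P) xor isOdd m (high P)
        ≡⟨ cong₂ _xor_ (isOdd-path low<m) (isOdd-path (top<m P)) ⟩
      odd (toℕ (low P)) xor odd (toℕ (high P))
        ≡⟨ cong (λ k → odd (toℕ (low P)) xor odd k) (gap P) ⟨
      odd i xor odd (i + suc (h + h))
        ≡⟨ cong (odd i xor_) (odd-+-odd i h) ⟩
      odd i xor not (odd i)
        ≡⟨ xor-inverseʳ (odd i) ⟩
      true
        ∎
  }
  where
  open ≡-Reasoning
  i = toℕ (low P)
  low<m : toℕ (low P) < m
  low<m = <-trans (low<high P) (top<m P)
  low≢high : low P ≢ high P
  low≢high = <⇒≢ᶠ (low<high P)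

-- The independent set and the independence number

module _ (m : ℕ) where

  slotPairAt : ∀ k → SlotPair m (lookup (slots m) k)
  slotPairAt k = slotPair m (∈-lookup k)

  -- Tabulated over positions because each pair is built from a proof that its slot is in the list.
  oddPairs : List (TwoSubset (m + 1))
  oddPairs = tabulate (subset ∘ slotPairAt)

  oddPairs-unique : Unique oddPairs
  oddPairs-unique = tabulate⁺ λ {k} {l} eq →
    lookup-injective (slots-unique m) (slotPair-injective (slotPairAt k) (slotPairAt l) eq)

  ∈-oddPairs⇒IsOddPair : ∀ {p} → p ∈ oddPairs → IsOddPair m p
  ∈-oddPairs⇒IsOddPair p∈ with k , refl ← ∈-tabulate⁻ p∈ = slotPair-isOddPair (slotPairAt k)

theorem1p1 : (m : ℕ) → 2 ≤ m → IndependenceNumber (doubleVertexGraph (fan m)) (m ^ 2 / 4)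
theorem1p1 m 2≤m =
  ( oddPairs m
  , ( oddPairs-unique m
    , λ p∈ q∈ → isOddPair⇒nonadjacent (∈-oddPairs⇒IsOddPair m p∈) (∈-oddPairs⇒IsOddPair m q∈))
  , trans (length-tabulate _) (length-slots m))
  , λ xs indep → subst (length xs ≤_) (length-slots m)
      (independent≤cliqueCover (fan₂ m) (slots m) _∈Clique_ (clique-cover 2≤m)
        clique-adjacent xs indep)
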